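{- Let $q$ be a power of $2$. Then in ${\rm PG}(4,q)$ there exist a set $\mathcal L$ of $q^3+1$ pairwise skew lines and a set $\mathcal P$ of $q^3+1$ planes any two of which intersect in exactly one point, such that no line of $\mathcal L$ is contained in a plane of $\mathcal P$. -}

module Defs where

open import Algebra.Bundles using (CommutativeRing)
import Algebra.Definitions
import Algebra.Definitions.RawMonoid
open import Data.Fin.Base using (Fin)
open import Data.Nat.Base using (ℕ; suc)
open import Data.Product using (_×_; ∃; ∃-syntax; ∃!)
open import Data.Vec.Functional using (Vector; replicate; zipWith; map)
import Data.Vec.Functional.Relation.Binary.Equality.Setoid
open import Function.Bundles using (Inverse)
open import Level using (Level; _⊔_) renaming (suc to lsuc)
open import Relation.Binary.PropositionalEquality using (setoid)
open import Relation.Nullary.Negation using (¬_)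
open import Relation.Unary using (Pred; _∈_; _⊆_; _≐_)

record Field (c ℓ : Level) : Set (lsuc (c ⊔ ℓ)) where
  field
    commutativeRing : CommutativeRing c ℓ

  open CommutativeRing commutativeRing public hiding (setoid)
  open Algebra.Definitions _≈_ using (Invertible)

  field
    1≉0           : ¬ (1# ≈ 0#)
    ≉0⇒invertible : ∀ x → ¬ (x ≈ 0#) → Invertible 1# _*_ x

HasOrder : ∀ {c ℓ} → Field c ℓ → ℕ → Set (c ⊔ ℓ)
HasOrder F q = Inverse (CommutativeRing.setoid (Field.commutativeRing F)) (setoid (Fin q))

module LinearAlgebra {c ℓ : Level} (F : Field c ℓ) where
  open Field F
  open Data.Vec.Functional.Relation.Binary.Equality.Setoid
    (CommutativeRing.setoid commutativeRing) public using (_≋_)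
  open Algebra.Definitions.RawMonoid +-rawMonoid using (sum)

  0ᵛ : ∀ {m} → Vector Carrier m
  0ᵛ = replicate _ 0#

  infixl 6 _+ᵛ_
  _+ᵛ_ : ∀ {m} → Vector Carrier m → Vector Carrier m → Vector Carrier m
  _+ᵛ_ = zipWith _+_

  infixr 7 _*ᵛ_
  _*ᵛ_ : ∀ {m} → Carrier → Vector Carrier m → Vector Carrier m
  a *ᵛ x = map (a *_) x

  linearCombination : ∀ {k m} → Vector Carrier k → Vector (Vector Carrier m) k → Vector Carrier m
  linearCombination a v j = sum (λ i → a i * v i j)

  record Subspace (m : ℕ) : Set (lsuc (c ⊔ ℓ)) where
    field
      vectors   : Pred (Vector Carrier m) (c ⊔ ℓ)
      resp-≋    : ∀ {x y} → x ≋ y → x ∈ vectors → y ∈ vectors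
      0ᵛ-closed : 0ᵛ ∈ vectors
      +ᵛ-closed : ∀ {x y} → x ∈ vectors → y ∈ vectors → x +ᵛ y ∈ vectors
      *ᵛ-closed : ∀ a {x} → x ∈ vectors → a *ᵛ x ∈ vectors

  record IsBasis {m k : ℕ} (U : Subspace m) (v : Vector (Vector Carrier m) k) : Set (c ⊔ ℓ) where
    open Subspace U
    field
      inside      : ∀ i → v i ∈ vectors
      independent : ∀ a → linearCombination a v ≋ 0ᵛ → a ≋ 0ᵛ
      spanning    : ∀ {x} → x ∈ vectors → ∃[ a ] x ≋ linearCombination a v

  HasDimension : ∀ {m} → Subspace m → ℕ → Set (c ⊔ ℓ)
  HasDimension {m} U k = ∃ λ (v : Vector (Vector Carrier m) k) → IsBasis U v

-- n is the projective dimension: flats are subspaces of F^(n+1).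
module PG {c ℓ : Level} (F : Field c ℓ) (n : ℕ) where
  open LinearAlgebra F

  -- k is likewise the projective dimension.
  record Flat (k : ℕ) : Set (lsuc (c ⊔ ℓ)) where
    field
      subspace  : Subspace (suc n)
      dimension : HasDimension subspace (suc k)

    open Subspace subspace public

  Point Line Plane : Set (lsuc (c ⊔ ℓ))
  Point = Flat 0
  Line  = Flat 1
  Plane = Flat 2

  infix 4 _⊑_ _≈ᶠ_

  _⊑_ : ∀ {j k} → Flat j → Flat k → Set (c ⊔ ℓ)
  S ⊑ T = Flat.vectors S ⊆ Flat.vectors T

  -- Equality of flats as sets, disregarding the chosen bases.
  _≈ᶠ_ : ∀ {k} → Flat k → Flat k → Set (c ⊔ ℓ)
  S ≈ᶠ T = Flat.vectors S ≐ Flat.vectors T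

  CommonPoint : ∀ {j k} → Flat j → Flat k → Point → Set (c ⊔ ℓ)
  CommonPoint S T p = p ⊑ S × p ⊑ T

  Skew : Line → Line → Set (lsuc (c ⊔ ℓ))
  Skew l m = ¬ ∃ (CommonPoint l m)

  MeetInExactlyOnePoint : Plane → Plane → Set (lsuc (c ⊔ ℓ))
  MeetInExactlyOnePoint π ρ = ∃! _≈ᶠ_ (CommonPoint π ρ)

{-# OPTIONS --safe #-}

-- Let θ³ = θ + d be an irreducible cubic over F. A nonzero 3×3 matrix M with Σ Mᵢⱼ θ^(i+j) = 0 has rank
-- at least two, because M = u vᵀ would give u(θ) v(θ) = 0. So the planes {(x, M x)} of PG(5,q) pairwise
-- meet in at most one point. Fix the point P = ⟨(e₀, 0)⟩ and the hyperplane H : y₀ = d x₀, with P ∉ H.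
-- The q³ planes of this kind through P cut H in pairwise skew lines, the q³ planes inside H pairwise meet
-- in exactly one point, and none of the former lines lies in one of the latter planes, since otherwise two
-- of the original planes would share that line. In the coordinates (x₀, x₁, x₂, y₁, y₂) of H ≅ PG(4,q)
-- these are `line` and `plane` below. A line in the plane x₁ = x₂ = 0 and a plane through the line x = 0
-- complete the two families.

module Submission where

open import Defs
open import Algebra.Bundles using (CommutativeRing)
import Algebra.Properties.CommutativeMonoid.Sum
import Algebra.Properties.Group
import Algebra.Properties.Ring
import Algebra.Properties.Semiring.Mult.TCOptimised
import Algebra.Properties.Semiring.Sum
import Algebra.Solver.Ring
open import Algebra.Solver.Ring.AlmostCommutativeRing
  using (fromCommutativeRing; _-Raw-AlmostCommutative⟶_)
open import Data.Fin.Base using (Fin; zero; suc; splitAt; finToFun; funToFin; punchIn; punchOut; join; combine)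
open import Data.Fin.Patterns using (0F; 1F; 2F; 3F; 4F)
open import Data.Fin.Properties using (_≟_; any?; all?; ¬∀⟶∃¬; punchIn-punchOut; injective⇒≤; funToFin-finToFin; join-splitAt)
open import Data.Integer.Base as ℤ using (ℤ; +_; -[1+_]; _⊖_)
import Data.Integer.Properties as ℤ
open import Data.Maybe.Base using (Maybe; just; nothing)
open import Data.Maybe.Relation.Binary.Pointwise using (Pointwise; just; nothing)
open import Data.Nat.Base as ℕ using (ℕ; zero; suc; _^_; _≤_)
import Data.Nat.Properties as ℕ
open import Data.Product.Base using (_×_; _,_; proj₁; proj₂; ∃-syntax; Σ-syntax)
import Data.Sign.Base as Sign
open import Data.Sum.Base using (_⊎_; inj₁; inj₂; [_,_]′)
open import Data.Vec.Functional using (Vector; []; _∷_)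
open import Function.Base using (_∘_)
open import Function.Bundles using (module Inverse)
open import Function.Definitions using (Injective)
open import Relation.Binary.PropositionalEquality as ≡ using (_≡_; _≢_)
open import Relation.Nullary.Decidable using (Dec; yes; no; ¬?; map′; decidable-stable)
open import Relation.Nullary.Negation using (¬_; contradiction)

-- A ring solver with integer coefficients

module IntegerCoefficients {c ℓ} (R : CommutativeRing c ℓ) where
  open CommutativeRing R
  open Algebra.Properties.Ring ring
  open Algebra.Properties.Semiring.Mult.TCOptimised semiring using (1+×; ×-homo-+; ×1-homo-*) renaming (_×_ to _×′_)
  open import Relation.Binary.Reasoning.Setoid setoid

  -- The canonical ring homomorphism. With this version of the multiple, `1 ×′ x` computes to `x`,
  -- so the constants 0 and 1 of a solver polynomial evaluate to `0#` and `1#` definitionally.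
  fromℤ : ℤ → Carrier
  fromℤ (+ n)    = n ×′ 1#
  fromℤ -[1+ n ] = - (suc n ×′ 1#)

  fromℤ-⊖ : ∀ m n → fromℤ (m ⊖ n) ≈ m ×′ 1# - n ×′ 1#
  fromℤ-⊖ m       zero    = sym (trans (+-congˡ -0#≈0#) (+-identityʳ _))
  fromℤ-⊖ zero    (suc n) = sym (+-identityˡ _)
  fromℤ-⊖ (suc m) (suc n) = begin
    fromℤ (suc m ⊖ suc n)                  ≡⟨ ≡.cong fromℤ (ℤ.[1+m]⊖[1+n]≡m⊖n m n) ⟩
    fromℤ (m ⊖ n)                          ≈⟨ fromℤ-⊖ m n ⟩
    m ×′ 1# - n ×′ 1#                      ≈⟨ +-congʳ (+-identityʳ _) ⟨
    m ×′ 1# + 0# - n ×′ 1#                 ≈⟨ +-congʳ (+-congˡ (-‿inverseʳ 1#)) ⟨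
    m ×′ 1# + (1# - 1#) - n ×′ 1#          ≈⟨ +-congʳ (+-assoc _ _ _) ⟨
    m ×′ 1# + 1# - 1# - n ×′ 1#            ≈⟨ +-assoc _ _ _ ⟩
    m ×′ 1# + 1# + (- 1# - n ×′ 1#)        ≈⟨ +-cong (+-comm _ _) (sym (trans (-‿cong (+-comm _ _)) (-‿anti-homo-+ _ _))) ⟩
    1# + m ×′ 1# - (1# + n ×′ 1#)          ≈⟨ +-cong (1+× m 1#) (-‿cong (1+× n 1#)) ⟨
    suc m ×′ 1# - suc n ×′ 1#              ∎

  fromℤ-neg : ∀ i → fromℤ (ℤ.- i) ≈ - fromℤ i
  fromℤ-neg (+ zero)  = sym -0#≈0#
  fromℤ-neg (+ suc n) = refl
  fromℤ-neg -[1+ n ]  = sym (-‿involutive _)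

  fromℤ-+ : ∀ i j → fromℤ (i ℤ.+ j) ≈ fromℤ i + fromℤ j
  fromℤ-+ (+ m)    (+ n)    = ×-homo-+ 1# m n
  fromℤ-+ (+ m)    -[1+ n ] = fromℤ-⊖ m (suc n)
  fromℤ-+ -[1+ m ] (+ n)    = trans (fromℤ-⊖ n (suc m)) (+-comm _ _)
  fromℤ-+ -[1+ m ] -[1+ n ] = begin
    - (suc (suc (m ℕ.+ n)) ×′ 1#)          ≡⟨ ≡.cong (λ k → - (suc k ×′ 1#)) (ℕ.+-suc m n) ⟨
    - ((suc m ℕ.+ suc n) ×′ 1#)            ≈⟨ -‿cong (×-homo-+ 1# (suc m) (suc n)) ⟩
    - (suc m ×′ 1# + suc n ×′ 1#)          ≈⟨ -‿+-comm _ _ ⟨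
    - (suc m ×′ 1#) - suc n ×′ 1#          ∎

  fromℤ-* : ∀ i j → fromℤ (i ℤ.* j) ≈ fromℤ i * fromℤ j
  fromℤ-* (+ m) (+ n) = begin
    fromℤ (Sign.+ ℤ.◃ (m ℕ.* n))           ≡⟨ ≡.cong fromℤ (ℤ.+◃n≡+n (m ℕ.* n)) ⟩
    (m ℕ.* n) ×′ 1#                        ≈⟨ ×1-homo-* m n ⟩
    m ×′ 1# * n ×′ 1#                      ∎
  fromℤ-* (+ m) -[1+ n ] = begin
    fromℤ (Sign.- ℤ.◃ (m ℕ.* suc n))       ≡⟨ ≡.cong fromℤ (ℤ.-◃n≡-n (m ℕ.* suc n)) ⟩
    fromℤ (ℤ.- (+ (m ℕ.* suc n)))          ≈⟨ fromℤ-neg (+ (m ℕ.* suc n)) ⟩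
    - ((m ℕ.* suc n) ×′ 1#)                ≈⟨ -‿cong (×1-homo-* m (suc n)) ⟩
    - (m ×′ 1# * suc n ×′ 1#)              ≈⟨ -‿distribʳ-* _ _ ⟩
    m ×′ 1# * - (suc n ×′ 1#)              ∎
  fromℤ-* -[1+ m ] (+ n) = begin
    fromℤ (Sign.- ℤ.◃ (suc m ℕ.* n))       ≡⟨ ≡.cong fromℤ (ℤ.-◃n≡-n (suc m ℕ.* n)) ⟩
    fromℤ (ℤ.- (+ (suc m ℕ.* n)))          ≈⟨ fromℤ-neg (+ (suc m ℕ.* n)) ⟩
    - ((suc m ℕ.* n) ×′ 1#)                ≈⟨ -‿cong (×1-homo-* (suc m) n) ⟩
    - (suc m ×′ 1# * n ×′ 1#)              ≈⟨ -‿distribˡ-* _ _ ⟩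
    - (suc m ×′ 1#) * n ×′ 1#              ∎
  fromℤ-* -[1+ m ] -[1+ n ] = begin
    (suc m ℕ.* suc n) ×′ 1#                ≈⟨ ×1-homo-* (suc m) (suc n) ⟩
    suc m ×′ 1# * suc n ×′ 1#              ≈⟨ -‿involutive _ ⟨
    - - (suc m ×′ 1# * suc n ×′ 1#)        ≈⟨ -‿cong (-‿distribˡ-* _ _) ⟩
    - (- (suc m ×′ 1#) * suc n ×′ 1#)      ≈⟨ -‿distribʳ-* _ _ ⟩
    - (suc m ×′ 1#) * - (suc n ×′ 1#)      ∎

  ℤ-homomorphism : ℤ.+-*-rawRing -Raw-AlmostCommutative⟶ fromCommutativeRing R
  ℤ-homomorphism = record
    { ⟦_⟧    = fromℤ
    ; +-homo = fromℤ-+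
    ; *-homo = fromℤ-*
    ; -‿homo = fromℤ-neg
    ; 0-homo = refl
    ; 1-homo = refl
    }

  -- Distinct integers may still agree in `R`, as in positive characteristic, so only equality of
  -- integers yields an answer.
  fromℤ-≟ : ∀ i j → Maybe (fromℤ i ≈ fromℤ j)
  fromℤ-≟ i j with i ℤ.≟ j
  ... | yes i≡j = just (reflexive (≡.cong fromℤ i≡j))
  ... | no  _   = nothing

  open Algebra.Solver.Ring ℤ.+-*-rawRing (fromCommutativeRing R) ℤ-homomorphism fromℤ-≟ public
    using (solve; _:=_; _:+_; _:*_; _:-_; :-_; con; Polynomial)

-- Self-maps of a finite set

-- If every value were attained, choose a preimage of each, replacing `a` by `b` wherever `a` was
-- chosen. Deleting `a` from the domain then yields an injection from `Fin (suc n)` into `Fin n`.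
nonInjective⇒nonSurjective : ∀ {n} (f : Fin n → Fin n) {a b} → a ≢ b → f a ≡ f b → ∃[ y ] ∀ x → f x ≢ y
nonInjective⇒nonSurjective {suc n} f {a} {b} a≢b fa≡fb with any? (λ y → all? (λ x → ¬? (f x ≟ y)))
... | yes missed = missed
... | no  onto   = contradiction (injective⇒≤ {f = proj₁ ∘ section} section-injective) (ℕ.<⇒≱ ℕ.≤-refl)
  where
  preimage : ∀ y → ∃[ x ] f x ≡ y
  preimage y with ¬∀⟶∃¬ _ _ (λ x → ¬? (f x ≟ y)) (λ none → onto (y , none))
  ... | x , fx = x , decidable-stable (f x ≟ y) fx

  section : ∀ y → ∃[ z ] f (punchIn a z) ≡ y
  section y with preimage y
  ... | x , fx≡y with a ≟ x
  ...   | yes ≡.refl = punchOut a≢b , ≡.trans (≡.cong f (punchIn-punchOut a≢b)) (≡.trans (≡.sym fa≡fb) fx≡y)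
  ...   | no  a≢x    = punchOut a≢x , ≡.trans (≡.cong f (punchIn-punchOut a≢x)) fx≡y

  section-injective : Injective _≡_ _≡_ (proj₁ ∘ section)
  section-injective {y} {y′} eq =
    ≡.trans (≡.sym (proj₂ (section y))) (≡.trans (≡.cong (f ∘ punchIn a) eq) (proj₂ (section y′)))

module FiniteField {c ℓ} (F : Field c ℓ) {q} (order : HasOrder F q) where
  open Field F hiding (zero)
  open LinearAlgebra F
  open PG F 4
  open Inverse order using (to; from; to-cong; inverseˡ; inverseʳ)
  open IntegerCoefficients commutativeRing
  open Algebra.Properties.Group +-group using () renaming (x≈y⇒x∙y⁻¹≈ε to x≈y⇒x-y≈0; x∙y⁻¹≈ε⇒x≈y to x-y≈0⇒x≈y)
  open Algebra.Properties.CommutativeMonoid.Sum +-commutativeMonoid using (sum-cong-≋; ∑-distrib-+; sum-replicate-zero)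
  open Algebra.Properties.Semiring.Sum semiring using (*-distribˡ-sum)
  open import Relation.Binary.Reasoning.Setoid (CommutativeRing.setoid commutativeRing)

  -- Decidable equality and zero divisors

  from-to : ∀ x → from (to x) ≈ x
  from-to x = inverseʳ ≡.refl

  infix 4 _≈?_
  _≈?_ : ∀ x y → Dec (x ≈ y)
  x ≈? y = map′ (λ eq → trans (sym (from-to x)) (trans (reflexive (≡.cong from eq)) (from-to y))) to-cong (to x ≟ to y)

  x*y≈0⇒x≈0∨y≈0 : ∀ {x y} → x * y ≈ 0# → x ≈ 0# ⊎ y ≈ 0#
  x*y≈0⇒x≈0∨y≈0 {x} {y} xy≈0 with x ≈? 0#
  ... | yes x≈0 = inj₁ x≈0
  ... | no  x≉0 with ≉0⇒invertible x x≉0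
  ...   | x⁻¹ , x⁻¹x≈1 , _ = inj₂ (begin
    y             ≈⟨ *-identityˡ y ⟨
    1# * y        ≈⟨ *-congʳ x⁻¹x≈1 ⟨
    x⁻¹ * x * y   ≈⟨ *-assoc _ _ _ ⟩
    x⁻¹ * (x * y) ≈⟨ *-congˡ xy≈0 ⟩
    x⁻¹ * 0#      ≈⟨ zeroʳ _ ⟩
    0#            ∎)

  x*y≈0∧x≉0⇒y≈0 : ∀ {x y} → x * y ≈ 0# → ¬ x ≈ 0# → y ≈ 0#
  x*y≈0∧x≉0⇒y≈0 xy≈0 x≉0 with x*y≈0⇒x≈0∨y≈0 xy≈0
  ... | inj₁ x≈0 = contradiction x≈0 x≉0
  ... | inj₂ y≈0 = y≈0

  x*x≈0⇒x≈0 : ∀ {x} → x * x ≈ 0# → x ≈ 0#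
  x*x≈0⇒x≈0 xx≈0 with x*y≈0⇒x≈0∨y≈0 xx≈0
  ... | inj₁ x≈0 = x≈0
  ... | inj₂ x≈0 = x≈0

  0*x+y≈y : ∀ {a x y} → x ≈ 0# → a * x + y ≈ y
  0*x+y≈y x≈0 = trans (+-congʳ (trans (*-congˡ x≈0) (zeroʳ _))) (+-identityˡ _)

  -- Ideal membership as a proof method: a polynomial identity found by the solver writes e in terms
  -- of vanishing expressions x and y with explicit cofactors a and b.
  vanish₂ : ∀ {e a x b y} → e ≈ a * x + b * y → x ≈ 0# → y ≈ 0# → e ≈ 0#
  vanish₂ {b = b} e≈ x≈0 y≈0 = trans e≈ (trans (0*x+y≈y x≈0) (trans (*-congˡ y≈0) (zeroʳ b)))

  vanish₃ : ∀ {e a x b y c z} → e ≈ a * x + (b * y + c * z) → x ≈ 0# → y ≈ 0# → z ≈ 0# → e ≈ 0#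
  vanish₃ e≈ x≈0 y≈0 z≈0 = trans e≈ (trans (0*x+y≈y x≈0) (vanish₂ refl y≈0 z≈0))

  -- Linear algebra

  ≋-sym : ∀ {m} {x y : Vector Carrier m} → x ≋ y → y ≋ x
  ≋-sym x≋y i = sym (x≋y i)

  ≋-trans : ∀ {m} {x y z : Vector Carrier m} → x ≋ y → y ≋ z → x ≋ z
  ≋-trans x≋y y≋z i = trans (x≋y i) (y≋z i)

  Independent : ∀ {m k} → Vector (Vector Carrier m) k → Set _
  Independent v = ∀ a → linearCombination a v ≋ 0ᵛ → a ≋ 0ᵛ

  linearCombination-0 : ∀ {m k} (v : Vector (Vector Carrier m) k) → linearCombination 0ᵛ v ≋ 0ᵛ
  linearCombination-0 {k = k} v j = trans (sum-cong-≋ {k} (λ i → zeroˡ (v i j))) (sum-replicate-zero k)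

  linearCombination-+ : ∀ {m k} a b (v : Vector (Vector Carrier m) k) →
    linearCombination (a +ᵛ b) v ≋ linearCombination a v +ᵛ linearCombination b v
  linearCombination-+ {k = k} a b v j = trans
    (sum-cong-≋ {k} (λ i → distribʳ (v i j) (a i) (b i)))
    (∑-distrib-+ (λ i → a i * v i j) (λ i → b i * v i j))

  linearCombination-* : ∀ {m k} b a (v : Vector (Vector Carrier m) k) →
    linearCombination (b *ᵛ a) v ≋ b *ᵛ linearCombination a v
  linearCombination-* {k = k} b a v j = trans
    (sum-cong-≋ {k} (λ i → *-assoc b (a i) (v i j)))
    (sym (*-distribˡ-sum b (λ i → a i * v i j)))

  span : ∀ {m k} → Vector (Vector Carrier m) k → Subspace m
  span v = record
    { vectors   = λ x → ∃[ a ] x ≋ linearCombination a v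
    ; resp-≋    = λ { x≋y (a , x≋) → a , ≋-trans (≋-sym x≋y) x≋ }
    ; 0ᵛ-closed = 0ᵛ , ≋-sym (linearCombination-0 v)
    ; +ᵛ-closed = λ { (a , x≋) (b , y≋) → a +ᵛ b , λ j →
        trans (+-cong (x≋ j) (y≋ j)) (sym (linearCombination-+ a b v j)) }
    ; *ᵛ-closed = λ { b (a , x≋) → b *ᵛ a , λ j →
        trans (*-congˡ (x≋ j)) (sym (linearCombination-* b a v j)) }
    }

  unit : ∀ {k} → Fin k → Vector Carrier k
  unit zero    = 1# ∷ 0ᵛ
  unit (suc i) = 0# ∷ unit i

  linearCombination-unit : ∀ {m k} (i : Fin k) (v : Vector (Vector Carrier m) k) →
    linearCombination (unit i) v ≋ v i
  linearCombination-unit zero v j = trans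
    (+-cong (*-identityˡ _) (linearCombination-0 (v ∘ suc) j))
    (+-identityʳ _)
  linearCombination-unit (suc i) v j =
    trans (+-cong (zeroˡ _) (linearCombination-unit i (v ∘ suc) j)) (+-identityˡ _)

  ∈span : ∀ {m k} (v : Vector (Vector Carrier m) k) i → Subspace.vectors (span v) (v i)
  ∈span v i = unit i , ≋-sym (linearCombination-unit i v)

  spanFlat : ∀ {k} (v : Vector (Vector Carrier 5) (suc k)) → Independent v → Flat k
  spanFlat v independent = record
    { subspace  = span v
    ; dimension = v , record { inside = ∈span v ; independent = independent ; spanning = λ x∈ → x∈ }
    }

  unit≉0 : ∀ {k} (i : Fin k) → ¬ unit i i ≈ 0#
  unit≉0 zero    = 1≉0
  unit≉0 (suc i) = unit≉0 i

  basis≉0 : ∀ {m k} {U : Subspace m} {v : Vector (Vector Carrier m) k} → IsBasis U v → ∀ i → ¬ v i ≋ 0ᵛ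
  basis≉0 {v = v} isBasis i vi≋0 =
    unit≉0 i (IsBasis.independent isBasis (unit i) (≋-trans (linearCombination-unit i v) vi≋0) i)

  nonzeroEntry : ∀ {k} {x : Vector Carrier k} → ¬ x ≋ 0ᵛ → ∃[ i ] ¬ x i ≈ 0#
  nonzeroEntry {x = x} = ¬∀⟶∃¬ _ _ (λ i → x i ≈? 0#)

  span₁⇒multiple : ∀ {m} {v x : Vector Carrier m} → Subspace.vectors (span (v ∷ [])) x → ∃[ a ] x ≋ a *ᵛ v
  span₁⇒multiple (a , x≋) = a zero , λ j → trans (x≋ j) (+-identityʳ _)

  multiple⇒span₁ : ∀ {m} {v x : Vector Carrier m} a → x ≋ a *ᵛ v → Subspace.vectors (span (v ∷ [])) x
  multiple⇒span₁ a x≋ = (a ∷ []) , λ j → trans (x≋ j) (sym (+-identityʳ _))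

  -- Incidence of points and flats in terms of vectors

  pointOf : (v : Vector Carrier 5) → ¬ v ≋ 0ᵛ → Point
  pointOf v v≉0 = spanFlat (v ∷ []) λ a av≋0 → λ where
    zero → x*y≈0∧x≉0⇒y≈0
      (trans (*-comm _ _) (trans (sym (+-identityʳ _)) (av≋0 (proj₁ (nonzeroEntry v≉0)))))
      (proj₂ (nonzeroEntry v≉0))

  pointOf-⊑ : ∀ {k} (S : Flat k) {v} (v≉0 : ¬ v ≋ 0ᵛ) → Flat.vectors S v → pointOf v v≉0 ⊑ S
  pointOf-⊑ S v≉0 v∈S x∈ with span₁⇒multiple x∈
  ... | a , x≋av = Flat.resp-≋ S (≋-sym x≋av) (Flat.*ᵛ-closed S a v∈S)

  -- The basis vector of `p` is a multiple a v with a nonzero, so scaling it by the inverse of a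
  -- recovers v.
  point⊑pointOf⇒⊒ : ∀ {v} (v≉0 : ¬ v ≋ 0ᵛ) (p : Point) → p ⊑ pointOf v v≉0 → pointOf v v≉0 ⊑ p
  point⊑pointOf⇒⊒ {v} v≉0 p p⊑ with Flat.dimension p
  ... | b , isBasis with span₁⇒multiple (p⊑ (IsBasis.inside isBasis zero))
  ... | a , b≋av with ≉0⇒invertible a (λ a≈0 →
    basis≉0 isBasis zero (λ j → trans (b≋av j) (trans (*-congʳ a≈0) (zeroˡ _))))
  ... | a⁻¹ , a⁻¹a≈1 , _ = pointOf-⊑ p v≉0 (Flat.resp-≋ p a⁻¹b≋v (Flat.*ᵛ-closed p a⁻¹ (IsBasis.inside isBasis zero)))
    where
    a⁻¹b≋v : a⁻¹ *ᵛ b zero ≋ v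
    a⁻¹b≋v j = begin
      a⁻¹ * b zero j  ≈⟨ *-congˡ (b≋av j) ⟩
      a⁻¹ * (a * v j) ≈⟨ *-assoc _ _ _ ⟨
      a⁻¹ * a * v j   ≈⟨ *-congʳ a⁻¹a≈1 ⟩
      1# * v j        ≈⟨ *-identityˡ _ ⟩
      v j             ∎

  meetInExactlyOnePoint : ∀ (π ρ : Plane) {v} → ¬ v ≋ 0ᵛ → Flat.vectors π v → Flat.vectors ρ v →
    (∀ {x} → Flat.vectors π x → Flat.vectors ρ x → ∃[ a ] x ≋ a *ᵛ v) → MeetInExactlyOnePoint π ρ
  meetInExactlyOnePoint π ρ {v} v≉0 v∈π v∈ρ multiple =
    pointOf v v≉0 , (pointOf-⊑ π v≉0 v∈π , pointOf-⊑ ρ v≉0 v∈ρ) ,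
    λ {p} (p⊑π , p⊑ρ) →
      let p⊑v : p ⊑ pointOf v v≉0
          p⊑v x∈p = let a , x≋av = multiple (p⊑π x∈p) (p⊑ρ x∈p) in multiple⇒span₁ a x≋av
      in point⊑pointOf⇒⊒ v≉0 p p⊑v , p⊑v

  meetInExactlyOnePoint-sym : ∀ {π ρ} → MeetInExactlyOnePoint π ρ → MeetInExactlyOnePoint ρ π
  meetInExactlyOnePoint-sym (p , (p⊑π , p⊑ρ) , unique) = p , (p⊑ρ , p⊑π) , λ {r} (r⊑ρ , r⊑π) → unique {r} (r⊑π , r⊑ρ)

  -- If the planes agreed, every basis vector of `π` would span a common point. Uniqueness would
  -- identify the points of the first two, making the second basis vector a multiple of the first.
  meetInExactlyOnePoint⇒≉ : ∀ {π ρ} → MeetInExactlyOnePoint π ρ → ¬ π ≈ᶠ ρ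
  meetInExactlyOnePoint⇒≉ {π} {ρ} (p , _ , unique) (π⊑ρ , _) with Flat.dimension π
  ... | b , isBasis with span₁⇒multiple {v = b 0F} {x = b 1F} (proj₁ (p≈ 0F) (proj₂ (p≈ 1F) (∈span (b 1F ∷ []) 0F)))
    where
    p≈ : ∀ i → p ≈ᶠ pointOf (b i) (basis≉0 isBasis i)
    p≈ i = unique {pointOf (b i) (basis≉0 isBasis i)}
      (pointOf-⊑ π (basis≉0 isBasis i) (IsBasis.inside isBasis i) , pointOf-⊑ ρ (basis≉0 isBasis i) (π⊑ρ (IsBasis.inside isBasis i)))
  ... | a , b₁≋ab₀ = 1≉0 (IsBasis.independent isBasis (- a ∷ 1# ∷ 0# ∷ []) relation 1F)
    where
    relation : linearCombination (- a ∷ 1# ∷ 0# ∷ []) b ≋ 0ᵛ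
    relation j = begin
      - a * b 0F j + (1# * b 1F j + (0# * b 2F j + 0#))       ≈⟨ +-congˡ (+-congʳ (*-congˡ (b₁≋ab₀ j))) ⟩
      - a * b 0F j + (1# * (a * b 0F j) + (0# * b 2F j + 0#))
        ≈⟨ solve 3 (λ a b c → :- a :* b :+ (con (+ 1) :* (a :* b) :+ (con (+ 0) :* c :+ con (+ 0))) := con (+ 0)) refl a (b 0F j) (b 2F j) ⟩
      0#                                                      ∎

  skew : ∀ (l m : Line) → (∀ {x} → Flat.vectors l x → Flat.vectors m x → x ≋ 0ᵛ) → Skew l m
  skew l m only0 (p , p⊑l , p⊑m) with Flat.dimension p
  ... | b , isBasis = basis≉0 isBasis zero (only0 (p⊑l (IsBasis.inside isBasis zero)) (p⊑m (IsBasis.inside isBasis zero)))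

  -- A line contains a point, which would be common to `l` and `m` if they agreed.
  skew⇒≉ : ∀ {l m} → Skew l m → ¬ l ≈ᶠ m
  skew⇒≉ {l} {m} l∦m (l⊑m , _) with Flat.dimension l
  ... | b , isBasis = l∦m (pointOf (b zero) b≉0 , pointOf-⊑ l b≉0 b∈l , pointOf-⊑ m b≉0 (l⊑m b∈l))
    where
    b≉0 = basis≉0 isBasis zero
    b∈l = IsBasis.inside isBasis zero

  -- Planes of PG(4,q) disjoint from the line x₀ = x₁ = x₂ = 0

  :0 :1 : ∀ {n} → Polynomial n
  :0 = con (+ 0)
  :1 = con (+ 1)

  infixl 7 _·_ _⊗_

  _·_ : Vector Carrier 3 → Vector Carrier 3 → Carrier
  f · x = f 0F * x 0F + f 1F * x 1F + f 2F * x 2F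

  ·-congˡ : ∀ {f x y} → x ≋ y → f · x ≈ f · y
  ·-congˡ x≋y = +-cong (+-cong (*-congˡ (x≋y 0F)) (*-congˡ (x≋y 1F))) (*-congˡ (x≋y 2F))

  ·-*ᵛ : ∀ f a x → f · (a *ᵛ x) ≈ a * (f · x)
  ·-*ᵛ f a x = solve 7 (λ f₀ f₁ f₂ a x₀ x₁ x₂ →
      f₀ :* (a :* x₀) :+ f₁ :* (a :* x₁) :+ f₂ :* (a :* x₂) := a :* (f₀ :* x₀ :+ f₁ :* x₁ :+ f₂ :* x₂))
    refl (f 0F) (f 1F) (f 2F) a (x 0F) (x 1F) (x 2F)

  _-ᵛ_ : Vector Carrier 3 → Vector Carrier 3 → Vector Carrier 3
  (f -ᵛ g) i = f i - g i

  ·-distrib--ᵛ : ∀ f g x → (f -ᵛ g) · x ≈ f · x - g · x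
  ·-distrib--ᵛ f g x = solve 9 (λ f₀ f₁ f₂ g₀ g₁ g₂ x₀ x₁ x₂ →
      (f₀ :- g₀) :* x₀ :+ (f₁ :- g₁) :* x₁ :+ (f₂ :- g₂) :* x₂
        := f₀ :* x₀ :+ f₁ :* x₁ :+ f₂ :* x₂ :- (g₀ :* x₀ :+ g₁ :* x₁ :+ g₂ :* x₂))
    refl (f 0F) (f 1F) (f 2F) (g 0F) (g 1F) (g 2F) (x 0F) (x 1F) (x 2F)

  -- The cross product on F³; despite the symbol, not a tensor product.
  _⊗_ : Vector Carrier 3 → Vector Carrier 3 → Vector Carrier 3
  f ⊗ g = (f 1F * g 2F - f 2F * g 1F) ∷ (f 2F * g 0F - f 0F * g 2F) ∷ (f 0F * g 1F - f 1F * g 0F) ∷ []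

  f·f⊗g≈0 : ∀ f g → f · (f ⊗ g) ≈ 0#
  f·f⊗g≈0 f g = solve 6 (λ f₀ f₁ f₂ g₀ g₁ g₂ →
      f₀ :* (f₁ :* g₂ :- f₂ :* g₁) :+ f₁ :* (f₂ :* g₀ :- f₀ :* g₂) :+ f₂ :* (f₀ :* g₁ :- f₁ :* g₀) := :0)
    refl (f 0F) (f 1F) (f 2F) (g 0F) (g 1F) (g 2F)

  g·f⊗g≈0 : ∀ f g → g · (f ⊗ g) ≈ 0#
  g·f⊗g≈0 f g = solve 6 (λ f₀ f₁ f₂ g₀ g₁ g₂ →
      g₀ :* (f₁ :* g₂ :- f₂ :* g₁) :+ g₁ :* (f₂ :* g₀ :- f₀ :* g₂) :+ g₂ :* (f₀ :* g₁ :- f₁ :* g₀) := :0)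
    refl (f 0F) (f 1F) (f 2F) (g 0F) (g 1F) (g 2F)

  -- (f ⊗ g) ⊗ x = (f · x) g − (g · x) f
  ⊥⇒parallel : ∀ f g x → f · x ≈ 0# → g · x ≈ 0# → ∀ i j → (f ⊗ g) i * x j ≈ (f ⊗ g) j * x i
  ⊥⇒parallel f g x f⊥x g⊥x = λ where
      0F 0F → refl
      1F 1F → refl
      2F 2F → refl
      0F 1F → p₀₁
      1F 0F → sym p₀₁
      1F 2F → p₁₂
      2F 1F → sym p₁₂
      2F 0F → p₂₀
      0F 2F → sym p₂₀
    where
    k = f ⊗ g
    -- One coordinate of the triple product identity; cyclic shifts of the indices give the other
    -- two.
    triple : ∀ f₀ f₁ f₂ g₀ g₁ g₂ x₀ x₁ x₂ →
      (f₁ * g₂ - f₂ * g₁) * x₁ - (f₂ * g₀ - f₀ * g₂) * x₀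
        ≈ g₂ * (f₀ * x₀ + f₁ * x₁ + f₂ * x₂) + - f₂ * (g₀ * x₀ + g₁ * x₁ + g₂ * x₂)
    triple = solve 9 (λ f₀ f₁ f₂ g₀ g₁ g₂ x₀ x₁ x₂ →
      (f₁ :* g₂ :- f₂ :* g₁) :* x₁ :- (f₂ :* g₀ :- f₀ :* g₂) :* x₀
        := g₂ :* (f₀ :* x₀ :+ f₁ :* x₁ :+ f₂ :* x₂) :+ :- f₂ :* (g₀ :* x₀ :+ g₁ :* x₁ :+ g₂ :* x₂)) refl
    rotate : ∀ {a b c} → a + b + c ≈ 0# → b + c + a ≈ 0#
    rotate {a} {b} {c} eq = trans (+-comm _ _) (trans (sym (+-assoc a b c)) eq)
    p₀₁ : k 0F * x 1F ≈ k 1F * x 0F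
    p₀₁ = x-y≈0⇒x≈y _ _ (vanish₂ (triple (f 0F) (f 1F) (f 2F) (g 0F) (g 1F) (g 2F) (x 0F) (x 1F) (x 2F)) f⊥x g⊥x)
    p₁₂ : k 1F * x 2F ≈ k 2F * x 1F
    p₁₂ = x-y≈0⇒x≈y _ _ (vanish₂ (triple (f 1F) (f 2F) (f 0F) (g 1F) (g 2F) (g 0F) (x 1F) (x 2F) (x 0F)) (rotate f⊥x) (rotate g⊥x))
    p₂₀ : k 2F * x 0F ≈ k 0F * x 2F
    p₂₀ = x-y≈0⇒x≈y _ _ (vanish₂ (triple (f 2F) (f 0F) (f 1F) (g 2F) (g 0F) (g 1F) (x 2F) (x 0F) (x 1F)) (rotate (rotate f⊥x)) (rotate (rotate g⊥x)))

  -- The factor is the quotient of `y i` by `x i` at an index where `x i` is nonzero.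
  parallel⇒multiple : ∀ {k} {x y : Vector Carrier k} → ¬ x ≋ 0ᵛ → (∀ i j → x i * y j ≈ x j * y i) → ∃[ a ] y ≋ a *ᵛ x
  parallel⇒multiple {x = x} {y} x≉0 parallel with nonzeroEntry x≉0
  ... | i , xi≉0 with ≉0⇒invertible (x i) xi≉0
  ... | r , rx≈1 , _ = r * y i , λ j → begin
    y j             ≈⟨ *-identityˡ _ ⟨
    1# * y j        ≈⟨ *-congʳ rx≈1 ⟨
    r * x i * y j   ≈⟨ *-assoc _ _ _ ⟩
    r * (x i * y j) ≈⟨ *-congˡ (parallel i j) ⟩
    r * (x j * y i) ≈⟨ *-congˡ (*-comm _ _) ⟩
    r * (y i * x j) ≈⟨ *-assoc _ _ _ ⟨
    r * y i * x j   ∎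

  head₃ : Vector Carrier 5 → Vector Carrier 3
  head₃ x = x 0F ∷ x 1F ∷ x 2F ∷ []

  -- The point over a of the graph of the linear map from F³ to F² with rows f and g.
  graphVector : (f g a : Vector Carrier 3) → Vector Carrier 5
  graphVector f g a = a 0F ∷ a 1F ∷ a 2F ∷ f · a ∷ g · a ∷ []

  graphBasis : (f g : Vector Carrier 3) → Vector (Vector Carrier 5) 3
  graphBasis f g =
    (1# ∷ 0# ∷ 0# ∷ f 0F ∷ g 0F ∷ []) ∷
    (0# ∷ 1# ∷ 0# ∷ f 1F ∷ g 1F ∷ []) ∷
    (0# ∷ 0# ∷ 1# ∷ f 2F ∷ g 2F ∷ []) ∷ []

  graph-lc : ∀ f g a → linearCombination a (graphBasis f g) ≋ graphVector f g a
  graph-lc f g a = λ where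
      0F → solve 3 (λ a b c → a :* :1 :+ (b :* :0 :+ (c :* :0 :+ :0)) := a) refl (a 0F) (a 1F) (a 2F)
      1F → solve 3 (λ a b c → a :* :0 :+ (b :* :1 :+ (c :* :0 :+ :0)) := b) refl (a 0F) (a 1F) (a 2F)
      2F → solve 3 (λ a b c → a :* :0 :+ (b :* :0 :+ (c :* :1 :+ :0)) := c) refl (a 0F) (a 1F) (a 2F)
      3F → dot f
      4F → dot g
    where
    dot : ∀ f → a 0F * f 0F + (a 1F * f 1F + (a 2F * f 2F + 0#)) ≈ f · a
    dot f = solve 6 (λ a b c x y z → a :* x :+ (b :* y :+ (c :* z :+ :0)) := x :* a :+ y :* b :+ z :* c) refl
      (a 0F) (a 1F) (a 2F) (f 0F) (f 1F) (f 2F)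

  graph : (f g : Vector Carrier 3) → Plane
  graph f g = spanFlat (graphBasis f g) λ a lc≋0 → let a≋0 = ≋-trans (≋-sym (graph-lc f g a)) lc≋0 in λ where
    0F → a≋0 0F
    1F → a≋0 1F
    2F → a≋0 2F

  ∈graph⇒ : ∀ f g {x} → Flat.vectors (graph f g) x → x ≋ graphVector f g (head₃ x)
  ∈graph⇒ f g {x} (a , x≋lc) = λ where
      0F → refl
      1F → refl
      2F → refl
      3F → trans (x≋ 3F) (·-congˡ {f} a≋x)
      4F → trans (x≋ 4F) (·-congˡ {g} a≋x)
    where
    x≋ = ≋-trans x≋lc (graph-lc f g a)
    a≋x : a ≋ head₃ x
    a≋x = λ where
      0F → sym (x≋ 0F)
      1F → sym (x≋ 1F)
      2F → sym (x≋ 2F)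

  ⇒∈graph : ∀ f g {x} → x ≋ graphVector f g (head₃ x) → Flat.vectors (graph f g) x
  ⇒∈graph f g {x} x≋ = head₃ x , ≋-trans x≋ (≋-sym (graph-lc f g (head₃ x)))

  -- Common vectors lie over the kernel of the 2×3 matrix with rows f - f′ and g - g′. A nonzero
  -- cross product means that the rows are independent, and it then spans this kernel.
  graphs-meet : ∀ f g f′ g′ → ¬ (f -ᵛ f′) ⊗ (g -ᵛ g′) ≋ 0ᵛ → MeetInExactlyOnePoint (graph f g) (graph f′ g′)
  graphs-meet f g f′ g′ k≉0 = meetInExactlyOnePoint (graph f g) (graph f′ g′) {v}
      (λ v≋0 → k≉0 λ { 0F → v≋0 0F ; 1F → v≋0 1F ; 2F → v≋0 2F })
      (⇒∈graph f g λ { 0F → refl ; 1F → refl ; 2F → refl ; 3F → refl ; 4F → refl })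
      (⇒∈graph f′ g′ λ { 0F → refl ; 1F → refl ; 2F → refl ; 3F → f·k≈f′·k ; 4F → g·k≈g′·k })
      multiple
    where
    k = (f -ᵛ f′) ⊗ (g -ᵛ g′)
    v = graphVector f g k
    f·k≈f′·k : f · k ≈ f′ · k
    f·k≈f′·k = x-y≈0⇒x≈y _ _ (trans (sym (·-distrib--ᵛ f f′ k)) (f·f⊗g≈0 (f -ᵛ f′) (g -ᵛ g′)))
    g·k≈g′·k : g · k ≈ g′ · k
    g·k≈g′·k = x-y≈0⇒x≈y _ _ (trans (sym (·-distrib--ᵛ g g′ k)) (g·f⊗g≈0 (f -ᵛ f′) (g -ᵛ g′)))
    multiple : ∀ {x} → Flat.vectors (graph f g) x → Flat.vectors (graph f′ g′) x → ∃[ a ] x ≋ a *ᵛ v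
    multiple {x} x∈ x∈′ = proj₁ y≋ , λ where
        0F → proj₂ y≋ 0F
        1F → proj₂ y≋ 1F
        2F → proj₂ y≋ 2F
        3F → trans (∈graph⇒ f g x∈ 3F) (trans (·-congˡ {f} (proj₂ y≋)) (·-*ᵛ f (proj₁ y≋) k))
        4F → trans (∈graph⇒ f g x∈ 4F) (trans (·-congˡ {g} (proj₂ y≋)) (·-*ᵛ g (proj₁ y≋) k))
      where
      y = head₃ x
      f-f′⊥y : (f -ᵛ f′) · y ≈ 0#
      f-f′⊥y = trans (·-distrib--ᵛ f f′ y) (x≈y⇒x-y≈0 (trans (sym (∈graph⇒ f g x∈ 3F)) (∈graph⇒ f′ g′ x∈′ 3F)))
      g-g′⊥y : (g -ᵛ g′) · y ≈ 0#
      g-g′⊥y = trans (·-distrib--ᵛ g g′ y) (x≈y⇒x-y≈0 (trans (sym (∈graph⇒ f g x∈ 4F)) (∈graph⇒ f′ g′ x∈′ 4F)))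
      y≋ : ∃[ a ] y ≋ a *ᵛ k
      y≋ = parallel⇒multiple k≉0 (⊥⇒parallel (f -ᵛ f′) (g -ᵛ g′) y f-f′⊥y g-g′⊥y)

  -- The rootless cubic

  cubic : Carrier → Carrier → Carrier
  cubic d z = z * z * z - z - d

  -- The map z ↦ z³ − z takes the value 0 at both 0 and 1, so it misses some d.
  rootlessCubic : ∃[ d ] ∀ z → ¬ cubic d z ≈ 0#
  rootlessCubic = from (proj₁ missed) , λ z root → proj₂ missed (to z)
      (≡.trans (f[to] z) (≡.trans (to-cong (x-y≈0⇒x≈y _ _ root)) (inverseˡ refl)))
    where
    f : Fin q → Fin q
    f i = to (from i * from i * from i - from i)
    f[to] : ∀ x → f (to x) ≡ to (x * x * x - x)
    f[to] x = to-cong (+-cong (*-cong (*-cong (from-to x) (from-to x)) (from-to x)) (-‿cong (from-to x)))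
    missed : ∃[ y ] ∀ x → f x ≢ y
    missed = nonInjective⇒nonSurjective f {to 0#} {to 1#}
      (λ eq → 1≉0 (trans (sym (from-to 1#)) (trans (reflexive (≡.cong from (≡.sym eq))) (from-to 0#))))
      (≡.trans (f[to] 0#) (≡.trans
        (to-cong (solve 0 (:0 :* :0 :* :0 :- :0 := :1 :* :1 :* :1 :- :1) refl))
        (≡.sym (f[to] 1#))))

  module Construction (d : Carrier) (rootless : ∀ z → ¬ cubic d z ≈ 0#) where

    -- The form is the homogenized cubic, that is, the norm of y - xθ. A zero with x nonzero would
    -- give the root y/x; for x = 0 the form is y³.
    homogenize-anisotropic : ∀ {x y} → y * y * y - y * x * x - d * x * x * x ≈ 0# → x ≈ 0# × y ≈ 0#
    homogenize-anisotropic {x} {y} eq with x ≈? 0#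
    ... | yes x≈0 = x≈0 , x*x≈0⇒x≈0 y²≈0
      where
      y³≈0 : y * (y * y) ≈ 0#
      y³≈0 = vanish₂ (solve 3 (λ d x y → y :* (y :* y)
          := :1 :* (y :* y :* y :- y :* x :* x :- d :* x :* x :* x) :+ (y :* x :+ d :* x :* x) :* x) refl d x y)
        eq x≈0
      y²≈0 : y * y ≈ 0#
      y²≈0 with x*y≈0⇒x≈0∨y≈0 y³≈0
      ... | inj₁ y≈0  = trans (*-congˡ y≈0) (zeroʳ y)
      ... | inj₂ yy≈0 = yy≈0
    ... | no x≉0 with ≉0⇒invertible x x≉0
    ...   | i , _ , xi≈1 = contradiction root (rootless (y * i))
      where
      root : cubic d (y * i) ≈ 0#
      -- The second summand accounts for i being the inverse of x: it collects (x i)² - 1 and (x i)³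
      -- - 1, both divisible by x i - 1.
      root = vanish₂ (solve 4 (λ d x y i →
          (y :* i) :* (y :* i) :* (y :* i) :- y :* i :- d
            := i :* i :* i :* (y :* y :* y :- y :* x :* x :- d :* x :* x :* x)
               :+ (y :* i :* (x :* i :+ :1) :+ d :* (x :* i :* (x :* i) :+ x :* i :+ :1)) :* (x :* i :- :1)) refl d x y i)
        eq (x≈y⇒x-y≈0 xi≈1)

    -- The hypotheses say that (d + aθ + bθ²)(1 + rθ + tθ²) = (btθ − 1)(θ³ − θ − d).
    -- Then bt·θ = 1 at a root of one of the two factors, whose remaining root (b or dt) is a root of the cubic.
    no-quadratic-product : ∀ a b r t → a * t + b * r + 1# ≈ 0# → d * t + a * r + b + b * t ≈ 0# →
      ¬ a - 1# + d * (b * t + r) ≈ 0#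
    no-quadratic-product a b r t h₁ h₂ h₃ = [ A≉0 , B≉0 ]′ (x*y≈0⇒x≈0∨y≈0 A*B≈0)
      where
      -- The first factor is 1 + rθ + tθ² at θ = b. By `h₃`, d times the second is d + aθ + bθ² at θ
      -- = dt. Showing that the product vanishes avoids dividing by bt.
      A*B≈0 : (1# + r * b + t * b * b) * (1# + t - d * r * t) ≈ 0#
      A*B≈0 = vanish₃ (solve 5 (λ d a b r t →
          (:1 :+ r :* b :+ t :* b :* b) :* (:1 :+ t :- d :* r :* t)
            := :1 :* (a :* t :+ b :* r :+ :1)
               :+ (t :* b :* (d :* t :+ a :* r :+ b :+ b :* t)
               :+ :- (t :+ t :* b :* r) :* (a :- :1 :+ d :* (b :* t :+ r)))) refl d a b r t)
        h₁ h₂ h₃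
      A≉0 : ¬ 1# + r * b + t * b * b ≈ 0#
      A≉0 A≈0 = rootless b (vanish₃ (solve 5 (λ d a b r t →
          b :* b :* b :- b :- d
            := b :* b :* (d :* t :+ a :* r :+ b :+ b :* t)
               :+ ((t :* b :* b :* b :+ b) :* (a :- :1 :+ d :* (b :* t :+ r))
               :+ :- (a :* b :+ b :* b :* d :* t :+ d) :* (:1 :+ r :* b :+ t :* b :* b))) refl d a b r t)
        h₂ h₃ A≈0)
      B≉0 : ¬ 1# + t - d * r * t ≈ 0#
      B≉0 B≈0 = rootless (d * t) (vanish₃ (solve 5 (λ d a b r t →
          d :* t :* (d :* t) :* (d :* t) :- d :* t :- d
            := d :* d :* t :* t :* (d :* t :+ a :* r :+ b :+ b :* t)
               :+ (:- (d :* d :* t :* t :* r) :* (a :- :1 :+ d :* (b :* t :+ r))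
               :+ :- (d :* (d :* t :* r :+ d :* t :* t :* b :+ :1)) :* (:1 :+ t :- d :* r :* t))) refl d a b r t)
        h₂ h₃ B≈0)

    -- The two families

    -- The matrices through P are those with rows (0, -dr, -dt), (0, dt - r, u), (0, -u, r): zero
    -- first column, and the relation at θ fixes the rest up to t, u, r. On the corresponding plane
    -- the equation y₀ = d x₀ of H becomes x₀ = -r x₁ - t x₂.
    lineBasis : Vector Carrier 3 → Vector (Vector Carrier 5) 2
    lineBasis τ =
      (- r ∷ 1# ∷ 0# ∷ d * t - r ∷ - u ∷ []) ∷
      (- t ∷ 0# ∷ 1# ∷ u ∷ r ∷ []) ∷ []
      where t = τ 0F ; u = τ 1F ; r = τ 2F

    lineVector : Vector Carrier 3 → Carrier → Carrier → Vector Carrier 5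
    lineVector τ x y = - r * x + - t * y ∷ x ∷ y ∷ (d * t - r) * x + u * y ∷ - u * x + r * y ∷ []
      where t = τ 0F ; u = τ 1F ; r = τ 2F

    line-lc : ∀ τ a → linearCombination a (lineBasis τ) ≋ lineVector τ (a 0F) (a 1F)
    line-lc τ a = λ where
        0F → swap _ _
        1F → solve 2 (λ x y → x :* :1 :+ (y :* :0 :+ :0) := x) refl (a 0F) (a 1F)
        2F → solve 2 (λ x y → x :* :0 :+ (y :* :1 :+ :0) := y) refl (a 0F) (a 1F)
        3F → swap _ _
        4F → swap _ _
      where
      swap : ∀ f g → a 0F * f + (a 1F * g + 0#) ≈ f * a 0F + g * a 1F
      swap f g = solve 4 (λ x y f g → x :* f :+ (y :* g :+ :0) := f :* x :+ g :* y) refl (a 0F) (a 1F) f g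

    line : Vector Carrier 3 → Line
    line τ = spanFlat (lineBasis τ) λ a lc≋0 → let a≋0 = ≋-trans (≋-sym (line-lc τ a)) lc≋0 in λ where
      0F → a≋0 1F
      1F → a≋0 2F

    ∈line⇒ : ∀ τ {x} → Flat.vectors (line τ) x → x ≋ lineVector τ (x 1F) (x 2F)
    ∈line⇒ τ {x} (a , x≋lc) = λ where
        0F → trans (x≋ 0F) substitute
        1F → refl
        2F → refl
        3F → trans (x≋ 3F) substitute
        4F → trans (x≋ 4F) substitute
      where
      x≋ = ≋-trans x≋lc (line-lc τ a)
      substitute : ∀ {f g} → f * a 0F + g * a 1F ≈ f * x 1F + g * x 2F
      substitute = +-cong (*-congˡ (sym (x≋ 1F))) (*-congˡ (sym (x≋ 2F)))

    ∈line-0 : ∀ τ {x} → Flat.vectors (line τ) x → x 1F ≈ 0# → x 2F ≈ 0# → x ≋ 0ᵛ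
    ∈line-0 τ x∈ x₁≈0 x₂≈0 = λ where
        0F → trans (∈line⇒ τ x∈ 0F) (vanish₂ refl x₁≈0 x₂≈0)
        1F → x₁≈0
        2F → x₂≈0
        3F → trans (∈line⇒ τ x∈ 3F) (vanish₂ refl x₁≈0 x₂≈0)
        4F → trans (∈line⇒ τ x∈ 4F) (vanish₂ refl x₁≈0 x₂≈0)

    -- The hypotheses are a homogeneous linear system in t, u, r whose determinant is the form of
    -- `homogenize-anisotropic`; the cofactors are the rows of the adjugate matrix.
    cramer : ∀ x y t u r → x * r + y * t ≈ 0# → (d * t - r) * x + u * y ≈ 0# → - u * x + r * y ≈ 0# →
      let n = y * y * y - y * x * x - d * x * x * x in n * t ≈ 0# × n * u ≈ 0# × n * r ≈ 0#
    cramer x y t u r e₁ e₂ e₃ =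
      vanish₃ (solve 6 (λ d x y t u r → (y :* y :* y :- y :* x :* x :- d :* x :* x :* x) :* t
          := (y :* y :- x :* x) :* (x :* r :+ y :* t)
             :+ (:- (x :* x) :* ((d :* t :- r) :* x :+ u :* y) :+ :- (x :* y) :* (:- u :* x :+ r :* y))) refl d x y t u r)
        e₁ e₂ e₃ ,
      vanish₃ (solve 6 (λ d x y t u r → (y :* y :* y :- y :* x :* x :- d :* x :* x :* x) :* u
          := :- (d :* x :* y) :* (x :* r :+ y :* t)
             :+ (y :* y :* ((d :* t :- r) :* x :+ u :* y) :+ (x :* y :+ d :* x :* x) :* (:- u :* x :+ r :* y))) refl d x y t u r)
        e₁ e₂ e₃ ,
      vanish₃ (solve 6 (λ d x y t u r → (y :* y :* y :- y :* x :* x :- d :* x :* x :* x) :* r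
          := :- (d :* x :* x) :* (x :* r :+ y :* t)
             :+ (x :* y :* ((d :* t :- r) :* x :+ u :* y) :+ y :* y :* (:- u :* x :+ r :* y))) refl d x y t u r)
        e₁ e₂ e₃

    -- At a common vector, τ - τ′ solves the system of `cramer` with coefficients from x₁ and x₂. As
    -- τ - τ′ is nonzero, the determinant vanishes, and anisotropy forces x₁ = x₂ = 0.
    lines-disjoint : ∀ τ τ′ → ¬ τ ≋ τ′ → ∀ {x} → Flat.vectors (line τ) x → Flat.vectors (line τ′) x → x ≋ 0ᵛ
    lines-disjoint τ τ′ τ≉τ′ {x} x∈ x∈′ = ∈line-0 τ x∈ (proj₁ x₁,x₂≈0) (proj₂ x₁,x₂≈0)
      where
      x₁ = x 1F ; x₂ = x 2F
      t = τ 0F ; u = τ 1F ; r = τ 2F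
      t′ = τ′ 0F ; u′ = τ′ 1F ; r′ = τ′ 2F
      n = x₂ * x₂ * x₂ - x₂ * x₁ * x₁ - d * x₁ * x₁ * x₁
      agree : ∀ j → lineVector τ′ x₁ x₂ j - lineVector τ x₁ x₂ j ≈ 0#
      agree j = x≈y⇒x-y≈0 (trans (sym (∈line⇒ τ′ x∈′ j)) (∈line⇒ τ x∈ j))
      agree′ : ∀ j → lineVector τ x₁ x₂ j - lineVector τ′ x₁ x₂ j ≈ 0#
      agree′ j = x≈y⇒x-y≈0 (trans (sym (∈line⇒ τ x∈ j)) (∈line⇒ τ′ x∈′ j))
      n*Δ≈0 : n * (t - t′) ≈ 0# × n * (u - u′) ≈ 0# × n * (r - r′) ≈ 0#
      n*Δ≈0 = cramer x₁ x₂ (t - t′) (u - u′) (r - r′)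
        (trans (solve 6 (λ x y t t′ r r′ →
            x :* (r :- r′) :+ y :* (t :- t′) := :- r′ :* x :+ :- t′ :* y :- (:- r :* x :+ :- t :* y)) refl x₁ x₂ t t′ r r′)
          (agree 0F))
        (trans (solve 9 (λ d x y t t′ u u′ r r′ →
            (d :* (t :- t′) :- (r :- r′)) :* x :+ (u :- u′) :* y
              := (d :* t :- r) :* x :+ u :* y :- ((d :* t′ :- r′) :* x :+ u′ :* y)) refl d x₁ x₂ t t′ u u′ r r′)
          (agree′ 3F))
        (trans (solve 6 (λ x y u u′ r r′ →
            :- (u :- u′) :* x :+ (r :- r′) :* y := :- u :* x :+ r :* y :- (:- u′ :* x :+ r′ :* y)) refl x₁ x₂ u u′ r r′)
          (agree′ 4F))
      n≈0 : n ≈ 0#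
      n≈0 = decidable-stable (n ≈? 0#) λ n≉0 → τ≉τ′ λ where
        0F → x-y≈0⇒x≈y _ _ (x*y≈0∧x≉0⇒y≈0 (proj₁ n*Δ≈0) n≉0)
        1F → x-y≈0⇒x≈y _ _ (x*y≈0∧x≉0⇒y≈0 (proj₁ (proj₂ n*Δ≈0)) n≉0)
        2F → x-y≈0⇒x≈y _ _ (x*y≈0∧x≉0⇒y≈0 (proj₂ (proj₂ n*Δ≈0)) n≉0)
      x₁,x₂≈0 = homogenize-anisotropic n≈0

    -- Each `line τ` misses the plane x₁ = x₂ = 0. The line chosen in it also has a point with x₀
    -- nonzero and a point over x = 0, which keep it out of `plane∞` and of every graph
    -- respectively.
    line∞Basis : Vector (Vector Carrier 5) 2
    line∞Basis = (1# ∷ 0ᵛ) ∷ (0# ∷ 0# ∷ 0# ∷ 1# ∷ 0# ∷ []) ∷ []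

    line∞ : Line
    line∞ = spanFlat line∞Basis λ a lc≋0 → λ where
      0F → trans (solve 2 (λ x y → x := x :* :1 :+ (y :* :0 :+ :0)) refl (a 0F) (a 1F)) (lc≋0 0F)
      1F → trans (solve 2 (λ x y → y := x :* :0 :+ (y :* :1 :+ :0)) refl (a 0F) (a 1F)) (lc≋0 3F)

    line∞-disjoint : ∀ τ {x} → Flat.vectors (line τ) x → Flat.vectors line∞ x → x ≋ 0ᵛ
    line∞-disjoint τ x∈ (a , x≋lc) = ∈line-0 τ x∈ (trans (x≋lc 1F) vanishes) (trans (x≋lc 2F) vanishes)
      where
      vanishes : a 0F * 0# + (a 1F * 0# + 0#) ≈ 0#
      vanishes = solve 2 (λ x y → x :* :0 :+ (y :* :0 :+ :0) := :0) refl (a 0F) (a 1F)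

    -- The second and third rows of a matrix whose first row is (d, 0, 0), so that its plane lies in
    -- H; the relation at θ leaves p, v, s free.
    planeF planeG : Vector Carrier 3 → Vector Carrier 3
    planeF σ = 1# - d * s ∷ p ∷ v ∷ []
      where p = σ 0F ; v = σ 1F ; s = σ 2F
    planeG σ = - (p + s) ∷ - (1# + v) ∷ s ∷ []
      where p = σ 0F ; v = σ 1F ; s = σ 2F

    plane : Vector Carrier 3 → Plane
    plane σ = graph (planeF σ) (planeG σ)

    planes-meet : ∀ σ σ′ → ¬ σ ≋ σ′ → MeetInExactlyOnePoint (plane σ) (plane σ′)
    planes-meet σ σ′ σ≉σ′ = graphs-meet (planeF σ) (planeG σ) (planeF σ′) (planeG σ′) λ k≋0 → σ≉σ′ (equal k≋0)
      where
      p = σ 0F ; v = σ 1F ; s = σ 2F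
      p′ = σ′ 0F ; v′ = σ′ 1F ; s′ = σ′ 2F
      equal : (planeF σ -ᵛ planeF σ′) ⊗ (planeG σ -ᵛ planeG σ′) ≋ 0ᵛ → σ ≋ σ′
      equal k≋0 = λ where
          -- Once s = s′, the last coordinate of the cross product reduces to (p - p′)².
          0F → x-y≈0⇒x≈y _ _ (x*x≈0⇒x≈0 (vanish₂ (solve 7 (λ d p p′ v v′ s s′ →
              (p :- p′) :* (p :- p′)
                := :1 :* ((:1 :- d :* s :- (:1 :- d :* s′)) :* (:- (:1 :+ v) :- :- (:1 :+ v′))
                          :- (p :- p′) :* (:- (p :+ s) :- :- (p′ :+ s′)))
                   :+ :- (d :* (v :- v′) :+ (p :- p′)) :* (s :- s′)) refl d p p′ v v′ s s′)
            (k≋0 2F) (proj₁ s,v)))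
          1F → sym (x-y≈0⇒x≈y _ _ (proj₂ s,v))
          2F → x-y≈0⇒x≈y _ _ (proj₁ s,v)
        where
        -- Eliminating p - p′ from the first two coordinates of the cross product leaves the
        -- anisotropic form at x = s - s′ and y = v′ - v.
        s,v : s - s′ ≈ 0# × v′ - v ≈ 0#
        s,v = homogenize-anisotropic (vanish₂ (solve 7 (λ d p p′ v v′ s s′ →
            (v′ :- v) :* (v′ :- v) :* (v′ :- v) :- (v′ :- v) :* (s :- s′) :* (s :- s′) :- d :* (s :- s′) :* (s :- s′) :* (s :- s′)
              := (v′ :- v) :* ((p :- p′) :* (s :- s′) :- (v :- v′) :* (:- (:1 :+ v) :- :- (:1 :+ v′)))
                 :+ (s′ :- s) :* ((v :- v′) :* (:- (p :+ s) :- :- (p′ :+ s′)) :- (:1 :- d :* s :- (:1 :- d :* s′)) :* (s :- s′)))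
            refl d p p′ v v′ s s′)
          (k≋0 0F) (k≋0 1F))

    plane∞Basis : Vector (Vector Carrier 5) 3
    plane∞Basis = (0# ∷ 1# ∷ 0ᵛ) ∷ (0# ∷ 0# ∷ 0# ∷ 1# ∷ 0# ∷ []) ∷ (0# ∷ 0# ∷ 0# ∷ 0# ∷ 1# ∷ []) ∷ []

    plane∞-lc : ∀ a → linearCombination a plane∞Basis ≋ (0# ∷ a 0F ∷ 0# ∷ a 1F ∷ a 2F ∷ [])
    plane∞-lc a = λ where
      0F → solve 3 (λ x y z → x :* :0 :+ (y :* :0 :+ (z :* :0 :+ :0)) := :0) refl (a 0F) (a 1F) (a 2F)
      1F → solve 3 (λ x y z → x :* :1 :+ (y :* :0 :+ (z :* :0 :+ :0)) := x) refl (a 0F) (a 1F) (a 2F)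
      2F → solve 3 (λ x y z → x :* :0 :+ (y :* :0 :+ (z :* :0 :+ :0)) := :0) refl (a 0F) (a 1F) (a 2F)
      3F → solve 3 (λ x y z → x :* :0 :+ (y :* :1 :+ (z :* :0 :+ :0)) := y) refl (a 0F) (a 1F) (a 2F)
      4F → solve 3 (λ x y z → x :* :0 :+ (y :* :0 :+ (z :* :1 :+ :0)) := z) refl (a 0F) (a 1F) (a 2F)

    plane∞ : Plane
    plane∞ = spanFlat plane∞Basis λ a lc≋0 → let a≋0 = ≋-trans (≋-sym (plane∞-lc a)) lc≋0 in λ where
      0F → a≋0 1F
      1F → a≋0 3F
      2F → a≋0 4F

    ∈plane∞⇒ : ∀ {x} → Flat.vectors plane∞ x → x 0F ≈ 0# × x 2F ≈ 0#
    ∈plane∞⇒ (a , x≋lc) = trans (x≋lc 0F) (plane∞-lc a 0F) , trans (x≋lc 2F) (plane∞-lc a 2F)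

    -- `plane∞` consists of the vectors over multiples of e = (0, 1, 0), and a graph has exactly one
    -- vector over each of them.
    plane∞-meets : ∀ σ → MeetInExactlyOnePoint (plane σ) plane∞
    plane∞-meets σ = meetInExactlyOnePoint (plane σ) plane∞ {v} (λ v≋0 → 1≉0 (v≋0 1F))
        (⇒∈graph f g λ { 0F → refl ; 1F → refl ; 2F → refl ; 3F → refl ; 4F → refl })
        ((1# ∷ f · e ∷ g · e ∷ []) ,
          ≋-trans (λ { 0F → refl ; 1F → refl ; 2F → refl ; 3F → refl ; 4F → refl }) (≋-sym (plane∞-lc (1# ∷ f · e ∷ g · e ∷ []))))
        multiple
      where
      f = planeF σ
      g = planeG σ
      e : Vector Carrier 3
      e = 0# ∷ 1# ∷ 0# ∷ []
      v = graphVector f g e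
      multiple : ∀ {x} → Flat.vectors (plane σ) x → Flat.vectors plane∞ x → ∃[ a ] x ≋ a *ᵛ v
      multiple {x} x∈ x∈∞ = x 1F , λ where
          0F → y≋ 0F
          1F → y≋ 1F
          2F → y≋ 2F
          3F → trans (∈graph⇒ f g x∈ 3F) (trans (·-congˡ {f} y≋) (·-*ᵛ f (x 1F) e))
          4F → trans (∈graph⇒ f g x∈ 4F) (trans (·-congˡ {g} y≋) (·-*ᵛ g (x 1F) e))
        where
        y≋ : head₃ x ≋ x 1F *ᵛ e
        y≋ = λ where
          0F → trans (proj₁ (∈plane∞⇒ x∈∞)) (sym (zeroʳ _))
          1F → sym (*-identityʳ _)
          2F → trans (proj₂ (∈plane∞⇒ x∈∞)) (sym (zeroʳ _))

    -- If the line lay in the plane, the two 3×3 matrices would differ by a rank one matrix u vᵀ.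
    -- Here u = (d, 1 - ds, -(p + s)) is the first column of the plane's matrix, as that of the
    -- line's is zero, and v = (1, r, t) annihilates the x-part of the line. The three equations
    -- obtained are the coefficients of u(θ) v(θ) = 0.
    line⋢plane : ∀ τ σ → ¬ line τ ⊑ plane σ
    line⋢plane τ σ l⊑π = no-quadratic-product (1# - d * s) (- (p + s)) r t
        (trans (solve 7 (λ d t u r p v s →
            (:1 :- d :* s) :* t :+ :- (p :+ s) :* r :+ :1
              := (:- u :- (:- (p :+ s) :* :- r :+ :- (:1 :+ v) :* :1 :+ s :* :0))
                 :+ (u :- ((:1 :- d :* s) :* :- t :+ p :* :0 :+ v :* :1))) refl d t u r p v s)
          (0+0≈0 (on 0F 4F) (on 1F 3F)))
        (trans (solve 6 (λ d t r p v s →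
            d :* t :+ (:1 :- d :* s) :* r :+ :- (p :+ s) :+ :- (p :+ s) :* t
              := (d :* t :- r :- ((:1 :- d :* s) :* :- r :+ p :* :1 :+ v :* :0))
                 :+ (r :- (:- (p :+ s) :* :- t :+ :- (:1 :+ v) :* :0 :+ s :* :1))) refl d t r p v s)
          (0+0≈0 (on 0F 3F) (on 1F 4F)))
        (trans (solve 6 (λ d t r p v s →
            :1 :- d :* s :- :1 :+ d :* (:- (p :+ s) :* t :+ r)
              := d :* (r :- (:- (p :+ s) :* :- t :+ :- (:1 :+ v) :* :0 :+ s :* :1))) refl d t r p v s)
          (trans (*-congˡ (on 1F 4F)) (zeroʳ d)))
      where
      t = τ 0F ; u = τ 1F ; r = τ 2F
      p = σ 0F ; v = σ 1F ; s = σ 2F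
      on : ∀ i j → lineBasis τ i j - graphVector (planeF σ) (planeG σ) (head₃ (lineBasis τ i)) j ≈ 0#
      on i j = x≈y⇒x-y≈0 (∈graph⇒ (planeF σ) (planeG σ) (l⊑π (∈span (lineBasis τ) i)) j)
      0+0≈0 : ∀ {x y} → x ≈ 0# → y ≈ 0# → x + y ≈ 0#
      0+0≈0 x≈0 y≈0 = trans (+-cong x≈0 y≈0) (+-identityˡ 0#)

    -- The families with their members at infinity

    lines : Maybe (Vector Carrier 3) → Line
    lines (just τ) = line τ
    lines nothing  = line∞

    planes : Maybe (Vector Carrier 3) → Plane
    planes (just σ) = plane σ
    planes nothing  = plane∞

    lines-skew : ∀ i j → ¬ Pointwise _≋_ i j → Skew (lines i) (lines j)
    lines-skew (just τ) (just τ′) i≉j = skew (line τ) (line τ′) (lines-disjoint τ τ′ (i≉j ∘ just))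
    lines-skew (just τ) nothing   _   = skew (line τ) line∞ (line∞-disjoint τ)
    lines-skew nothing  (just τ)  _   = skew line∞ (line τ) (λ x∈∞ x∈ → line∞-disjoint τ x∈ x∈∞)
    lines-skew nothing  nothing   i≉j = contradiction nothing i≉j

    planes-meetInExactlyOnePoint : ∀ i j → ¬ Pointwise _≋_ i j → MeetInExactlyOnePoint (planes i) (planes j)
    planes-meetInExactlyOnePoint (just σ) (just σ′) i≉j = planes-meet σ σ′ (i≉j ∘ just)
    planes-meetInExactlyOnePoint (just σ) nothing   _   = plane∞-meets σ
    planes-meetInExactlyOnePoint nothing  (just σ)  _   = meetInExactlyOnePoint-sym {plane σ} {plane∞} (plane∞-meets σ)
    planes-meetInExactlyOnePoint nothing  nothing   i≉j = contradiction nothing i≉j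

    lines⋢planes : ∀ i j → ¬ lines i ⊑ planes j
    lines⋢planes (just τ) (just σ) = line⋢plane τ σ
    -- In the remaining cases one basis vector is the witness: it has x₂ = 1 or x₀ = 1, excluded on
    -- `plane∞`, or it is a nonzero vector over x = 0, excluded on a graph.
    lines⋢planes (just τ) nothing  l⊑π = 1≉0 (proj₂ (∈plane∞⇒ (l⊑π (∈span (lineBasis τ) 1F))))
    lines⋢planes nothing  (just σ) l⊑π = 1≉0 (trans
      (∈graph⇒ (planeF σ) (planeG σ) (l⊑π (∈span line∞Basis 1F)) 3F)
      (vanish₃ (+-assoc _ _ _) refl refl refl))
    lines⋢planes nothing  nothing  l⊑π = 1≉0 (proj₁ (∈plane∞⇒ (l⊑π (∈span line∞Basis 0F))))

  -- Indexing by q³ + 1 elements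

  finToFun-injective : ∀ {m n} {i j : Fin (m ^ n)} → (∀ k → finToFun {m} {n} i k ≡ finToFun j k) → i ≡ j
  finToFun-injective {m} {n} {i} {j} eq = ≡.trans (≡.sym (funToFin-finToFin {m = n} {n = m} i))
    (≡.trans (funToFin-cong eq) (funToFin-finToFin {m = n} {n = m} j))
    where
    -- Pointwise agreement takes the place of function extensionality.
    funToFin-cong : ∀ {m n} {f g : Fin n → Fin m} → (∀ k → f k ≡ g k) → funToFin f ≡ funToFin g
    funToFin-cong {n = zero}  _  = ≡.refl
    funToFin-cong {n = suc n} eq = ≡.cong₂ combine (eq zero) (funToFin-cong (eq ∘ suc))

  -- An index below q³ is read as three digits in `Fin q`, each naming a field element; the single
  -- extra index stands for the member at infinity.
  decode⊎ : Fin (q ^ 3) ⊎ Fin 1 → Maybe (Vector Carrier 3)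
  decode⊎ (inj₁ i) = just (λ k → from (finToFun i k))
  decode⊎ (inj₂ _) = nothing

  decode⊎-injective : ∀ i j → Pointwise _≋_ (decode⊎ i) (decode⊎ j) → i ≡ j
  decode⊎-injective (inj₁ i)    (inj₁ j)    (just eq) = ≡.cong inj₁ (finToFun-injective {q} {3} λ k →
    ≡.trans (≡.sym (inverseˡ refl)) (≡.trans (to-cong (eq k)) (inverseˡ refl)))
  decode⊎-injective (inj₂ zero) (inj₂ zero) nothing   = ≡.refl

  decode : Fin (q ^ 3 ℕ.+ 1) → Maybe (Vector Carrier 3)
  decode i = decode⊎ (splitAt (q ^ 3) i)

  decode-injective : ∀ {i j} → Pointwise _≋_ (decode i) (decode j) → i ≡ j
  decode-injective {i} {j} eq = ≡.trans (≡.sym (join-splitAt (q ^ 3) 1 i))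
    (≡.trans (≡.cong (join (q ^ 3) 1) (decode⊎-injective _ _ eq)) (join-splitAt (q ^ 3) 1 j))

open import Data.Nat.Base using (_+_)

theorem3p9 : ∀ {c ℓ} (q h : ℕ) → 1 ≤ h → q ≡ 2 ^ h →
    (F : Field c ℓ) → HasOrder F q →
    let open PG F 4 in
    Σ[ 𝓛 ∈ (Fin (q ^ 3 + 1) → Line) ]
    Σ[ 𝓟 ∈ (Fin (q ^ 3 + 1) → Plane) ]
    Injective _≡_ _≈ᶠ_ 𝓛
    × Injective _≡_ _≈ᶠ_ 𝓟
    × (∀ i j → i ≢ j → Skew (𝓛 i) (𝓛 j))
    × (∀ i j → i ≢ j → MeetInExactlyOnePoint (𝓟 i) (𝓟 j))
    × (∀ i j → ¬ (𝓛 i ⊑ 𝓟 j))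
theorem3p9 q h _ _ F order =
  (λ i → lines (decode i)) , (λ i → planes (decode i)) ,
  -- Injectivity follows from the pairwise conditions: neither skewness nor meeting in exactly one
  -- point can hold between equal flats.
  (λ {i} {j} eq → decidable-stable (i ≟ j) λ i≢j → skew⇒≉ {lines (decode i)} {lines (decode j)} (skew′ i j i≢j) eq) ,
  (λ {i} {j} eq → decidable-stable (i ≟ j) λ i≢j → meetInExactlyOnePoint⇒≉ {planes (decode i)} {planes (decode j)} (meet i j i≢j) eq) ,
  skew′ , meet , (λ i j → lines⋢planes (decode i) (decode j))
  where
  open PG F 4
  open FiniteField F order
  open Construction (proj₁ rootlessCubic) (proj₂ rootlessCubic)
  skew′ : ∀ i j → i ≢ j → Skew (lines (decode i)) (lines (decode j))
  skew′ i j i≢j = lines-skew (decode i) (decode j) (i≢j ∘ decode-injective)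
  meet : ∀ i j → i ≢ j → MeetInExactlyOnePoint (planes (decode i)) (planes (decode j))
  meet i j i≢j = planes-meetInExactlyOnePoint (decode i) (decode j) (i≢j ∘ decode-injective)
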